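{- Let $\mathscr{S}=(\mathscr{P},\mathscr{L},\mathscr{I})$ be a projective plane and let $\mathbf{P}\subseteq\mathscr{P}$ be a finite set of points. Then one of the following statements holds: (1) $|\mathbf{P}_3|\geq \frac14 |\mathbf{P}|^2$; (2) $\mathbf{P}_1$ is equal to the set of points of a projective subplane of $\mathscr{S}$, or to the set of points of a projective subplane of $\mathscr{S}$ minus one point; (3) $\mathbf{P}$ is a degenerate subplane of $\mathscr{S}$.
   Context: An incidence system is a triple $(\mathscr{P},\mathscr{L},\mathscr{I})$ of a set of points $\mathscr{P}$, a set of lines $\mathscr{L}$ and a relation $\mathscr{I}\subseteq\mathscr{P}\times\mathscr{L}$ (incidence). A projective plane (not assumed finite, Desarguesian or Pappian) is an incidence system satisfying: (P1) any two distinct points are incident with exactly one common line; (P2) any two distinct lines are incident with exactly one common point; (P3) there exist four points, no three of which are incident with the same line. A degenerate projective plane is an incidence system satisfying (P1) and (P2) but not (P3). Given a set of points $\mathbf{P}$ of a projective plane, define $\mathbf{P}_0=\mathbf{P}$; for $i\ge 0$, $\mathbf{L}_i$ is the set of lines of $\mathscr{L}$ incident with at least two points of $\mathbf{P}_i$; for $i\ge 1$, $\mathbf{P}_i$ is the set of points of $\mathscr{P}$ incident with at least two lines of $\mathbf{L}_{i-1}$. A set $Q\subseteq\mathscr{P}$ is the set of points of a projective subplane of $\mathscr{S}$ if there is a set of lines $\mathscr{L}'\subseteq\mathscr{L}$ such that $Q$, $\mathscr{L}'$ and the restriction of $\mathscr{I}$ to $Q\times\mathscr{L}'$ form a projective plane.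 A set $Q\subseteq\mathscr{P}$ is a degenerate subplane if there is $\mathscr{L}'\subseteq\mathscr{L}$ such that $Q$, $\mathscr{L}'$ and the restriction of $\mathscr{I}$ to $Q\times \mathscr{L}'$ form a degenerate projective plane; this means that either all points of $Q$ lie on a common line of $\mathscr{L}$, or $Q$ is the point set of a fan, i.e. there is a line of $\mathscr{L}$ incident with all points of $Q$ except exactly one. -}

module Defs where

open import Data.Fin using (Fin)
open import Data.Nat using (ℕ; zero; suc)
open import Data.Product using (_×_; ∃-syntax; ∃!)
open import Data.Refinement using (Refinement-syntax; value)
open import Function.Bundles using (_↔_)
open import Function.Definitions using (Injective)
open import Level using (Level) renaming (suc to lsuc)
open import Relation.Binary.PropositionalEquality using (_≡_; _≢_)
open import Relation.Nullary using (¬_)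
open import Relation.Unary using (Pred; _∈_; _≐_; _∖_; ｛_｝)

private
  variable
    ℓ : Level

-- Refinement types compare elements by their underlying value only, so this
-- is a bijection between Fin n and the subset Q itself.
HasCardinality : {A : Set ℓ} → Pred A ℓ → ℕ → Set ℓ
HasCardinality {A = A} Q n = Fin n ↔ [ x ∈ A ∣ Q x ]

record IncidenceSystem (ℓ : Level) : Set (lsuc ℓ) where
  infix 4 _I_
  field
    Point : Set ℓ
    Line  : Set ℓ
    _I_   : Point → Line → Set ℓ

module _ (S : IncidenceSystem ℓ) where
  open IncidenceSystem S

  P1 : Set ℓ
  P1 = ∀ {p q : Point} → p ≢ q → ∃! _≡_ λ l → p I l × q I l

  P2 : Set ℓ
  P2 = ∀ {l m : Line} → l ≢ m → ∃! _≡_ λ p → p I l × p I m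

  P3 : Set ℓ
  P3 = ∃[ v ] Injective _≡_ _≡_ v × NoThreeCollinear v
    where
    NoThreeCollinear : (Fin 4 → Point) → Set ℓ
    NoThreeCollinear v = ∀ {i j k} → i ≢ j → i ≢ k → j ≢ k →
      ¬ (∃[ l ] v i I l × v j I l × v k I l)

  record IsProjectivePlane : Set ℓ where
    field
      p1 : P1
      p2 : P2
      p3 : P3

  record IsDegenerateProjectivePlane : Set ℓ where
    field
      p1  : P1
      p2  : P2
      ¬p3 : ¬ P3

  restrict : Pred Point ℓ → Pred Line ℓ → IncidenceSystem ℓ
  restrict Q L′ = record
    { Point = [ p ∈ Point ∣ Q p ]
    ; Line  = [ l ∈ Line ∣ L′ l ]
    ; _I_   = λ p l → value p I value l
    }

module _ (S : IncidenceSystem ℓ) where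
  open IncidenceSystem S

  IsSubplane : Pred Point ℓ → Set (lsuc ℓ)
  IsSubplane Q = ∃[ L′ ] IsProjectivePlane (restrict S Q L′)

  IsDegenerateSubplane : Pred Point ℓ → Set (lsuc ℓ)
  IsDegenerateSubplane Q = ∃[ L′ ] IsDegenerateProjectivePlane (restrict S Q L′)

  IsSubplaneMinusPoint : Pred Point ℓ → Set (lsuc ℓ)
  IsSubplaneMinusPoint R =
    ∃[ Q ] ∃[ x ] IsSubplane Q × x ∈ Q × R ≐ (Q ∖ ｛ x ｝)

  linesThroughTwo : Pred Point ℓ → Pred Line ℓ
  linesThroughTwo Q l =
    ∃[ p ] ∃[ q ] p ≢ q × p ∈ Q × q ∈ Q × p I l × q I l

  pointsOnTwo : Pred Line ℓ → Pred Point ℓ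
  pointsOnTwo M p =
    ∃[ l ] ∃[ m ] l ≢ m × l ∈ M × m ∈ M × p I l × p I m

  mutual
    points : Pred Point ℓ → ℕ → Pred Point ℓ
    points P zero    = P
    points P (suc i) = pointsOnTwo (lines P i)

    lines : Pred Point ℓ → ℕ → Pred Line ℓ
    lines P i = linesThroughTwo (points P i)

{-# OPTIONS --safe #-}
-- Let n = |P|, and suppose P contains two points off any given line; then P ⊆ P₁ ⊆ P₂ ⊆ P₃.
-- Two points on a and b lines of Lᵢ other than their join give a b points of Pᵢ₊₁.
-- If a line carries more than n / 2 points of P, two points of P off it are on enough lines of L₀.
-- Otherwise, two points of P₂ \ P₁ are on enough lines of L₂, because each is on at most one
-- line of L₀. If P₂ \ P₁ is empty, then P₁ is closed under meets of its lines. If it is a single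
-- point x, then all joins of x to P₁ already belong to L₁, so P₂ is closed.
module Submission where

open import Defs
open import Axiom.ExcludedMiddle using (ExcludedMiddle)
open import Data.Empty using (⊥; ⊥-elim)
open import Data.Fin using (Fin; zero; suc)
open import Data.Fin.Patterns using (0F; 1F; 2F; 3F)
open import Data.Fin.Properties using (injective⇒≤)
open import Data.Irrelevant using ([_])
open import Data.List using
  (List; []; _∷_; _++_; length; map; filter; lookup; tabulate; deduplicate;
   cartesianProduct; cartesianProductWith)
open import Data.List.Properties using (length-map; length-++; length-tabulate)
open import Data.List.Membership.Propositional using (_∈_)
open import Data.List.Membership.Propositional.Properties using
  (∈-map⁻; ∈-filter⁺; ∈-filter⁻; ∈-lookup; ∈-tabulate⁺; ∈-tabulate⁻;
   ∈-deduplicate⁺; ∈-deduplicate⁻; ∈-cartesianProduct⁻; ∈-cartesianProductWith⁺; ∈-++⁻)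
open import Data.List.Relation.Unary.All using (All; []; _∷_)
import Data.List.Relation.Unary.All as All
open import Data.List.Relation.Unary.AllPairs using ([]; _∷_)
open import Data.List.Relation.Unary.Any using (here; there; index)
open import Data.List.Relation.Unary.Any.Properties using (lookup-index)
open import Data.List.Relation.Unary.Unique.Propositional using (Unique)
open import Data.List.Relation.Unary.Unique.Propositional.Properties using
  (++⁺; filter⁺; tabulate⁺; cartesianProduct⁺)
import Data.List.Relation.Unary.Unique.DecPropositional.Properties as DecUnique
open import Data.Nat using (ℕ; zero; suc; _+_; _*_; _^_; _≤_; _≥_; _<_; z≤n; s≤s)
open import Data.Nat.Properties using
  (+-suc; +-identityʳ; +-monoˡ-≤; +-monoʳ-≤; +-cancelˡ-≤; *-suc; *-identityʳ; *-mono-≤; *-monoʳ-≤;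
   *-cancelˡ-<; ≤-trans; ≤-reflexive; ≤-pred; ≮⇒≥; 1+n≰n; m≤m+n; module ≤-Reasoning)
open import Data.Nat.Tactic.RingSolver using (solve-∀)
open import Data.Product using (_×_; _,_; ∃-syntax; Σ-syntax; proj₁; proj₂; uncurry)
open import Data.Refinement using (Refinement-syntax; value; _,_)
open import Data.Refinement.Properties using (value-injective)
open import Data.Sum using (_⊎_; inj₁; inj₂; [_,_]′)
open import Function using (_∘_; mk↔ₛ′; Injection; Inverse)
open import Function.Properties.Inverse using (↔⇒↣)
open import Function.Definitions using (Injective)
open import Level using (Level)
open import Relation.Binary.PropositionalEquality
  using (_≡_; _≢_; refl; sym; trans; cong; cong₂; subst; ≢-sym)
open import Relation.Nullary using (¬_; Dec; yes; no; ¬?)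
open import Relation.Nullary.Decidable using (recompute; decidable-stable)
open import Relation.Unary using (Pred; Decidable)

-- If one line contains all points of `P` with at most one exception, then `P` is a degenerate
-- subplane; otherwise every line misses two points of `P`. The factor 1/4 is the product of two
-- pencils of about n / 2 lines each, and the difficulty is the unit lost when the join of the two
-- centres is discarded. When no line carries more than n / 2 points, a point of P₂ outside P₁ has
-- at least n / 2 + 1 distinct joins with `P`, so n / 2 lines survive. These centres appear only in
-- P₂, which is why the meets of their lines are found in P₃. When some line does carry more than n
-- / 2 points there may be no line to spare: for odd n both pencils may be left with (n - 1) / 2
-- lines, which makes the grid short by (2n - 1) / 4, and further points on the discarded join have
-- to fill the gap.

private
  variable
    α β : Level
    A : Set α
    B : Set β

-- Duplicate-free lists and counting

lookup-injective : {xs : List A} → Unique xs → Injective _≡_ _≡_ (lookup xs)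
lookup-injective {xs = _ ∷ _}  (_ ∷ _)  {zero}  {zero}  _  = refl
lookup-injective {xs = _ ∷ xs} (px ∷ _) {zero}  {suc j} eq =
  ⊥-elim (All.lookup px (∈-lookup {xs = xs} j) eq)
lookup-injective {xs = _ ∷ xs} (px ∷ _) {suc i} {zero}  eq =
  ⊥-elim (All.lookup px (∈-lookup {xs = xs} i) (sym eq))
lookup-injective {xs = _ ∷ _}  (_ ∷ u)  {suc i} {suc j} eq =
  cong suc (lookup-injective u eq)

unique-⊆⇒length≤ : {xs ys : List A} → Unique xs → (∀ {x} → x ∈ xs → x ∈ ys) →
                   length xs ≤ length ys
unique-⊆⇒length≤ {xs = xs} {ys} u xs⊆ys = injective⇒≤ {f = position} position-injective
  where
  mem : ∀ i → lookup xs i ∈ ys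
  mem i = xs⊆ys (∈-lookup {xs = xs} i)
  position : Fin (length xs) → Fin (length ys)
  position i = index (mem i)
  position-injective : Injective _≡_ _≡_ position
  position-injective {i} {j} eq = lookup-injective u
    (trans (lookup-index (mem i)) (trans (cong (lookup ys) eq) (sym (lookup-index (mem j)))))

map-unique : {f : A → B} {xs : List A} →
             (∀ {x y} → x ∈ xs → y ∈ xs → f x ≡ f y → x ≡ y) →
             Unique xs → Unique (map f xs)
map-unique {xs = []} _ _ = []
map-unique {f = f} {xs = x ∷ xs} inj (px ∷ u) =
  All.tabulate fx≢ ∷ map-unique (λ x∈ y∈ → inj (there x∈) (there y∈)) u
  where
  fx≢ : ∀ {y} → y ∈ map f xs → f x ≢ y
  fx≢ y∈ fx≡y with ∈-map⁻ f y∈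
  ... | z , z∈ , refl = All.lookup px z∈ (inj (here refl) (there z∈) fx≡y)

length-cartesianProduct : (xs : List A) (ys : List B) →
                          length (cartesianProduct xs ys) ≡ length xs * length ys
length-cartesianProduct []       ys = refl
length-cartesianProduct (x ∷ xs) ys =
  trans (length-++ (map (x ,_) ys))
        (cong₂ _+_ (length-map (x ,_) ys) (length-cartesianProduct xs ys))

length-filter-¬ : ∀ {p} {P : Pred A p} (P? : Decidable P) xs →
                  length xs ≡ length (filter P? xs) + length (filter (¬? ∘ P?) xs)
length-filter-¬ P? [] = refl
length-filter-¬ P? (x ∷ xs) with P? x
... | yes _ = cong suc (length-filter-¬ P? xs)
... | no  _ = trans (cong suc (length-filter-¬ P? xs)) (sym (+-suc (length (filter P? xs)) _))

-- Numerical estimates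

-- Ensures that a line with more than half of the points has a third one to give away in
-- `avoid-one`.
3≤half : ∀ {n k} → n < 2 * k → 4 ≤ n → 3 ≤ k
3≤half n<2k 4≤n = *-cancelˡ-< 2 2 _ (≤-trans (s≤s 4≤n) n<2k)

2+n≤2*n : ∀ {n} → 4 ≤ n → 2 + n ≤ 2 * n
2+n≤2*n {n} 4≤n = ≤-trans (+-monoˡ-≤ n (≤-trans (s≤s (s≤s z≤n)) 4≤n))
  (≤-reflexive (cong (n +_) (sym (+-identityʳ n))))

-- Here `k` and `m` count the points of `P` on and off a line, and `suc m` adds one point of that
-- line. The slack `2 +` pays for the line deleted in `drop-one`.
half-off : ∀ n {k m} → n ≡ k + m → 2 * k ≤ n → 2 + n ≤ 2 * suc m
half-off n {k} {m} refl 2k≤ = ≤-trans (+-monoʳ-≤ 2 (+-monoˡ-≤ m k≤m)) (≤-reflexive (solve-m m))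
  where
  k≤m : k ≤ m
  k≤m = +-cancelˡ-≤ k k m (≤-trans (≤-reflexive (cong (k +_) (sym (+-identityʳ k)))) 2k≤)
  solve-m : ∀ m → 2 + (m + m) ≡ 2 * suc m
  solve-m = solve-∀

drop-one : ∀ {n k m} → 2 + n ≤ 2 * k → k ≤ suc m → n ≤ 2 * m
drop-one {n} {k} {m} 2+n≤2k k≤1+m = +-cancelˡ-≤ 2 n (2 * m)
  (≤-trans 2+n≤2k (≤-trans (*-monoʳ-≤ 2 k≤1+m) (≤-reflexive (*-suc 2 m))))

product-bound : ∀ {n k m} → n ≤ 2 * k → n ≤ 2 * m → n ^ 2 ≤ 4 * (k * m)
product-bound {n} {k} {m} n≤2k n≤2m = begin
  n ^ 2             ≡⟨ cong (n *_) (*-identityʳ n) ⟩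
  n * n             ≤⟨ *-mono-≤ n≤2k n≤2m ⟩
  2 * k * (2 * m)   ≡⟨ expand k m ⟩
  4 * (k * m)       ∎
  where
  open ≤-Reasoning
  expand : ∀ k m → 2 * k * (2 * m) ≡ 4 * (k * m)
  expand = solve-∀

-- If n = 2k − 1 and c = d = k − 1, the two sides differ by 3.
rich-bound : ∀ {n k c d} → n < 2 * k → k ≤ suc c → k ≤ suc d → n ^ 2 ≤ 4 * (c * d + k)
rich-bound {n} {suc j} {c} {d} n<2k (s≤s j≤c) (s≤s j≤d) = begin
  n ^ 2                          ≡⟨ cong (n *_) (*-identityʳ n) ⟩
  n * n                          ≤⟨ *-mono-≤ n≤ n≤ ⟩
  (1 + 2 * j) * (1 + 2 * j)      ≤⟨ m≤m+n _ 3 ⟩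
  (1 + 2 * j) * (1 + 2 * j) + 3  ≡⟨ expand j ⟩
  4 * (j * j + suc j)            ≤⟨ *-monoʳ-≤ 4 (+-monoˡ-≤ (suc j) (*-mono-≤ j≤c j≤d)) ⟩
  4 * (c * d + suc j)            ∎
  where
  open ≤-Reasoning
  n≤ : n ≤ 1 + 2 * j
  n≤ = ≤-pred (≤-trans n<2k (≤-reflexive (*-suc 2 j)))
  expand : ∀ j → (1 + 2 * j) * (1 + 2 * j) + 3 ≡ 4 * (j * j + suc j)
  expand = solve-∀

-- Finite subsets under excluded middle

module Classical (em : ∀ {a} → ExcludedMiddle a) where

  stable : {P : Set α} → ¬ ¬ P → P
  stable = decidable-stable em

  deleteAll : A → List A → List A
  deleteAll x = filter (λ y → ¬? (em {P = y ≡ x}))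

  length≤1+deleteAll : ∀ (x : A) {xs} → Unique xs → length xs ≤ suc (length (deleteAll x xs))
  length≤1+deleteAll x {xs} u = unique-⊆⇒length≤ u xs⊆
    where
    xs⊆ : ∀ {y} → y ∈ xs → y ∈ x ∷ deleteAll x xs
    xs⊆ {y} y∈ with em {P = y ≡ x}
    ... | yes refl = here refl
    ... | no  y≢x  = there (∈-filter⁺ (λ z → ¬? (em {P = z ≡ x})) y∈ y≢x)

  -- The working form of finiteness: a duplicate-free list can be filtered, mapped and compared by
  -- inclusion more directly than a bijection with `Fin n`.
  record Enumeration {A : Set α} (Q : Pred A α) : Set α where
    field
      list     : List A
      unique   : Unique list
      sound    : ∀ {x} → x ∈ list → Q x
      complete : ∀ {x} → Q x → x ∈ list

  open Enumeration

  ⊆-list⇒enumeration : {A : Set α} {Q : Pred A α} (xs : List A) →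
                       (∀ {x} → Q x → x ∈ xs) → Enumeration Q
  ⊆-list⇒enumeration {A = A} {Q} xs Q⊆xs = record
    { list     = deduplicate _≟_ ys
    ; unique   = DecUnique.deduplicate-! _≟_ ys
    ; sound    = λ x∈ → proj₂ (∈-filter⁻ Q? {xs = xs} (∈-deduplicate⁻ _≟_ ys x∈))
    ; complete = λ q → ∈-deduplicate⁺ _≟_ (∈-filter⁺ Q? (Q⊆xs q) q)
    }
    where
    _≟_ : (x y : A) → Dec (x ≡ y)
    _ ≟ _ = em
    Q? : Decidable Q
    Q? _ = em
    ys : List A
    ys = filter Q? xs

  hasCardinality⇒enumeration : {A : Set α} {Q : Pred A α} {n : ℕ} → HasCardinality Q n →
                               Σ[ e ∈ Enumeration Q ] length (list e) ≡ n
  hasCardinality⇒enumeration {Q = Q} {n} bij = record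
    { list     = tabulate element
    ; unique   = tabulate⁺ λ eq → Injection.injective (↔⇒↣ bij) (value-injective eq)
    ; sound    = λ x∈ → let i , eq = ∈-tabulate⁻ x∈ in subst Q (sym eq) (element∈Q i)
    ; complete = λ {x} q → subst (_∈ tabulate element)
        (cong value (Inverse.strictlyInverseˡ bij (x , [ q ])))
        (∈-tabulate⁺ (Inverse.from bij (x , [ q ])))
    } , length-tabulate element
    where
    element : Fin n → _
    element i = value (Inverse.to bij i)
    element∈Q : ∀ i → Q (element i)
    element∈Q i with Inverse.to bij i
    -- A refinement stores its membership proof irrelevantly; excluded middle recovers a usable one.
    ... | _ , [ q ] = recompute em q

  enumeration⇒hasCardinality : {A : Set α} {Q : Pred A α} (e : Enumeration Q) →
                               HasCardinality Q (length (list e))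
  enumeration⇒hasCardinality {A = A} {Q} e = mk↔ₛ′ to from to-from from-to
    where
    to : Fin (length (list e)) → [ x ∈ A ∣ Q x ]
    to i = lookup (list e) i , [ sound e (∈-lookup {xs = list e} i) ]
    from : [ x ∈ A ∣ Q x ] → Fin (length (list e))
    from (x , [ q ]) = index (complete e (recompute em q))
    to-from : ∀ y → to (from y) ≡ y
    to-from (x , [ q ]) = value-injective (sym (lookup-index (complete e (recompute em q))))
    from-to : ∀ i → from (to i) ≡ i
    from-to i = lookup-injective (unique e) (sym (lookup-index (complete e _)))

-- Joins, meets and one step of the closure

module Plane (em : ∀ {a} → ExcludedMiddle a)
             {ℓ : Level} (S : IncidenceSystem ℓ) (plane : IsProjectivePlane S) where
  open IncidenceSystem S
  open IsProjectivePlane plane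
  open Classical em
  open Enumeration

  private
    variable
      o p q : Point
      l m : Line
      Q : Pred Point ℓ
      M : Pred Line ℓ

  linesOf : Pred Point ℓ → Pred Line ℓ
  linesOf = linesThroughTwo S

  pointsOf : Pred Line ℓ → Pred Point ℓ
  pointsOf = pointsOnTwo S

  line-≡ : p ≢ q → p I l → q I l → p I m → q I m → l ≡ m
  line-≡ p≢q pl ql pm qm with p1 p≢q
  ... | _ , _ , ! = trans (sym (! (pl , ql))) (! (pm , qm))

  point-≡ : l ≢ m → p I l → p I m → q I l → q I m → p ≡ q
  point-≡ l≢m pl pm ql qm = stable λ p≢q → l≢m (line-≡ p≢q pl ql pm qm)

  distinct-lines : p I l → ¬ p I m → l ≢ m
  distinct-lines pl p∉m refl = p∉m pl

  distinct-points : p I l → ¬ q I l → p ≢ q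
  distinct-points pl q∉l refl = q∉l pl

  point₀ point₁ : Point
  point₀ = proj₁ p3 zero
  point₁ = proj₁ p3 (suc zero)

  point₀≢point₁ : point₀ ≢ point₁
  point₀≢point₁ eq with proj₁ (proj₂ p3) eq
  ... | ()

  line₀ : Line
  line₀ = proj₁ (p1 point₀≢point₁)

  -- join and meet take the junk values line₀ and point₀ on equal arguments.
  join : Point → Point → Line
  join p q with em {P = p ≡ q}
  ... | yes _   = line₀
  ... | no  p≢q = proj₁ (p1 p≢q)

  meet : Line → Line → Point
  meet l m with em {P = l ≡ m}
  ... | yes _   = point₀
  ... | no  l≢m = proj₁ (p2 l≢m)

  join-Iˡ : p ≢ q → p I join p q
  join-Iˡ {p} {q} p≢q with em {P = p ≡ q}
  ... | yes p≡q = ⊥-elim (p≢q p≡q)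
  ... | no  p≢q = proj₁ (proj₁ (proj₂ (p1 p≢q)))

  join-Iʳ : p ≢ q → q I join p q
  join-Iʳ {p} {q} p≢q with em {P = p ≡ q}
  ... | yes p≡q = ⊥-elim (p≢q p≡q)
  ... | no  p≢q = proj₂ (proj₁ (proj₂ (p1 p≢q)))

  meet-Iˡ : l ≢ m → meet l m I l
  meet-Iˡ {l} {m} l≢m with em {P = l ≡ m}
  ... | yes l≡m = ⊥-elim (l≢m l≡m)
  ... | no  l≢m = proj₁ (proj₁ (proj₂ (p2 l≢m)))

  meet-Iʳ : l ≢ m → meet l m I m
  meet-Iʳ {l} {m} l≢m with em {P = l ≡ m}
  ... | yes l≡m = ⊥-elim (l≢m l≡m)
  ... | no  l≢m = proj₂ (proj₁ (proj₂ (p2 l≢m)))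

  join-≡ : p ≢ q → p I l → q I l → join p q ≡ l
  join-≡ p≢q = line-≡ p≢q (join-Iˡ p≢q) (join-Iʳ p≢q)

  meet-≡ : l ≢ m → p I l → p I m → meet l m ≡ p
  meet-≡ l≢m = point-≡ l≢m (meet-Iˡ l≢m) (meet-Iʳ l≢m)

  line-through : ∀ p → ∃[ l ] p I l
  line-through p with em {P = p ≡ point₀}
  ... | yes refl = _ , join-Iˡ point₀≢point₁
  ... | no  p≢   = _ , join-Iˡ p≢

  join∈linesOf : p ≢ q → Q p → Q q → linesOf Q (join p q)
  join∈linesOf p≢q p∈Q q∈Q = _ , _ , p≢q , p∈Q , q∈Q , join-Iˡ p≢q , join-Iʳ p≢q

  meet∈pointsOf : l ≢ m → M l → M m → pointsOf M (meet l m)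
  meet∈pointsOf l≢m l∈M m∈M = _ , _ , l≢m , l∈M , m∈M , meet-Iˡ l≢m , meet-Iʳ l≢m

  linesOf-mono : {R : Pred Point ℓ} → (∀ {p} → Q p → R p) → linesOf Q l → linesOf R l
  linesOf-mono Q⊆R (_ , _ , p≢q , p∈ , q∈ , pl , ql) = _ , _ , p≢q , Q⊆R p∈ , Q⊆R q∈ , pl , ql

  Noncollinear : Pred Point ℓ → Set ℓ
  Noncollinear Q = ∀ l → ∃[ p ] Q p × ¬ p I l

  ⊆pointsOf-linesOf : Noncollinear Q → Q p → pointsOf (linesOf Q) p
  ⊆pointsOf-linesOf {p = p} nc p∈Q =
    -- An arbitrary line through `p`: a point off it is automatically different from `p`.
    let _ , pl         = line-through p
        q , q∈Q , q∉l  = nc _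
        p≢q            = distinct-points pl q∉l
        r , r∈Q , r∉pq = nc (join p q)
        p≢r            = distinct-points (join-Iˡ p≢q) r∉pq
    in join p q , join p r , ≢-sym (distinct-lines (join-Iʳ p≢r) r∉pq) ,
       join∈linesOf p≢q p∈Q q∈Q , join∈linesOf p≢r p∈Q r∈Q , join-Iˡ p≢q , join-Iˡ p≢r

  noncollinear-next : Noncollinear Q → Noncollinear (pointsOf (linesOf Q))
  noncollinear-next nc l = let p , p∈Q , p∉l = nc l in p , ⊆pointsOf-linesOf nc p∈Q , p∉l

  enumerate-next : Enumeration Q → Enumeration (pointsOf (linesOf Q))
  enumerate-next {Q = Q} e = ⊆-list⇒enumeration (cartesianProductWith meet joins joins)
    λ (l , m , l≢m , l∈ , m∈ , pl , pm) →
      subst (_∈ cartesianProductWith meet joins joins) (meet-≡ l≢m pl pm)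
        (∈-cartesianProductWith⁺ meet (∈joins l∈) (∈joins m∈))
    where
    joins : List Line
    joins = cartesianProductWith join (list e) (list e)
    ∈joins : linesOf Q l → l ∈ joins
    ∈joins (_ , _ , p≢q , p∈ , q∈ , pl , ql) =
      subst (_∈ joins) (join-≡ p≢q pl ql)
        (∈-cartesianProductWith⁺ join (complete e p∈) (complete e q∈))

  -- The perspectivity with centre `o` onto `l`.
  project : Point → Line → Point → Point
  project o l p = meet (join o p) l

  project-I : ¬ o I l → o ≢ p → project o l p I l
  project-I o∉l o≢p = meet-Iʳ (distinct-lines (join-Iˡ o≢p) o∉l)

  project-I-join : ¬ o I l → o ≢ p → project o l p I join o p
  project-I-join o∉l o≢p = meet-Iˡ (distinct-lines (join-Iˡ o≢p) o∉l)

  join-injective : ¬ o I m → p I m → q I m → join o p ≡ join o q → p ≡ q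
  join-injective {o} {m} {p} {q} o∉m pm qm eq =
    point-≡ (distinct-lines (join-Iˡ o≢p) o∉m) (join-Iʳ o≢p) pm
      (subst (q I_) (sym eq) (join-Iʳ (≢-sym (distinct-points qm o∉m)))) qm
    where
    o≢p : o ≢ p
    o≢p = ≢-sym (distinct-points pm o∉m)

  -- As `o` is off `l`, an image differs from the centre and so determines the line through it,
  -- which cuts `m` only once.
  project-injective : ¬ o I l → ¬ o I m → p I m → q I m →
                      project o l p ≡ project o l q → p ≡ q
  project-injective {o} {l} {m} {p} {q} o∉l o∉m pm qm eq = join-injective o∉m pm qm
    (line-≡ o≢p′ (join-Iˡ o≢p) (project-I-join o∉l o≢p)
      (join-Iˡ o≢q) (subst (_I join o q) (sym eq) (project-I-join o∉l o≢q)))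
    where
    o≢p : o ≢ p
    o≢p = ≢-sym (distinct-points pm o∉m)
    o≢q : o ≢ q
    o≢q = ≢-sym (distinct-points qm o∉m)
    o≢p′ : o ≢ project o l p
    o≢p′ = ≢-sym (distinct-points (project-I o∉l o≢p) o∉l)

  -- Quadrangles and subplanes

  -- Stored as two pairs, each off the line of the other. Any three of the four points contain one
  -- of the pairs, so these four non-incidences exclude every collinear triple.
  record Quadrangle (Q : Pred Point ℓ) : Set ℓ where
    field
      {a b c d} : Point
      {ab cd}   : Line
      a≢b  : a ≢ b
      c≢d  : c ≢ d
      a∈Q  : Q a
      b∈Q  : Q b
      c∈Q  : Q c
      d∈Q  : Q d
      a-ab : a I ab
      b-ab : b I ab
      c-cd : c I cd
      d-cd : d I cd
      a∉cd : ¬ a I cd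
      b∉cd : ¬ b I cd
      c∉ab : ¬ c I ab
      d∉ab : ¬ d I ab

  quadrangle-mono : {R : Pred Point ℓ} → (∀ {p} → Q p → R p) → Quadrangle Q → Quadrangle R
  quadrangle-mono Q⊆R quad = record
    { Quadrangle quad
    ; a∈Q = Q⊆R a∈Q ; b∈Q = Q⊆R b∈Q ; c∈Q = Q⊆R c∈Q ; d∈Q = Q⊆R d∈Q }
    where open Quadrangle quad

  linesOf-p1 : P1 (restrict S Q (linesOf Q))
  linesOf-p1 {p = p , [ p∈ ]} {q , [ q∈ ]} p≢q =
    (join p q , [ join∈linesOf p≢q′ p∈ q∈ ]) , (join-Iˡ p≢q′ , join-Iʳ p≢q′) ,
    λ (pl , ql) → value-injective (join-≡ p≢q′ pl ql)
    where
    p≢q′ : p ≢ q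
    p≢q′ = p≢q ∘ value-injective

  closed⇒p2 : (∀ {l m} → l ≢ m → M l → M m → Q (meet l m)) → P2 (restrict S Q M)
  closed⇒p2 closed {l , [ l∈ ]} {m , [ m∈ ]} l≢m =
    (meet l m , [ closed l≢m′ l∈ m∈ ]) , (meet-Iˡ l≢m′ , meet-Iʳ l≢m′) ,
    λ (pl , pm) → value-injective (meet-≡ l≢m′ pl pm)
    where
    l≢m′ : l ≢ m
    l≢m′ = l≢m ∘ value-injective

  -- With the joins of points of `Q` as lines, P1 is automatic, so only P2 calls for closure under
  -- meets.
  closed⇒subplane : Quadrangle Q →
    (∀ {l m} → l ≢ m → linesOf Q l → linesOf Q m → Q (meet l m)) → IsSubplane S Q
  closed⇒subplane {Q = Q} quad closed = linesOf Q , record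
    { p1 = linesOf-p1
    ; p2 = closed⇒p2 closed
    ; p3 = vertex , vertex-injective , λ { i≢j i≢k j≢k ((l , _) , il , jl , kl) →
        noThree l i≢j i≢k j≢k il jl kl }
    }
    where
    open Quadrangle quad
    vertex : Fin 4 → [ p ∈ Point ∣ Q p ]
    vertex 0F                   = a , [ a∈Q ]
    vertex 1F             = b , [ b∈Q ]
    vertex 2F       = c , [ c∈Q ]
    vertex 3F = d , [ d∈Q ]

    no-abc : ∀ l → a I l → b I l → c I l → ⊥
    no-abc l al bl cl = c∉ab (subst (c I_) (line-≡ a≢b al bl a-ab b-ab) cl)
    no-abd : ∀ l → a I l → b I l → d I l → ⊥
    no-abd l al bl dl = d∉ab (subst (d I_) (line-≡ a≢b al bl a-ab b-ab) dl)
    no-acd : ∀ l → a I l → c I l → d I l → ⊥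
    no-acd l al cl dl = a∉cd (subst (a I_) (line-≡ c≢d cl dl c-cd d-cd) al)
    no-bcd : ∀ l → b I l → c I l → d I l → ⊥
    no-bcd l bl cl dl = b∉cd (subst (b I_) (line-≡ c≢d cl dl c-cd d-cd) bl)

    vertex-injective : Injective _≡_ _≡_ vertex
    vertex-injective {i} {j} eq = injective i j (cong value eq)
      where
      injective : ∀ i j → value (vertex i) ≡ value (vertex j) → i ≡ j
      injective 0F 0F eq = refl
      injective 0F 1F eq = ⊥-elim (a≢b eq)
      injective 0F 2F eq = ⊥-elim (distinct-points a-ab c∉ab eq)
      injective 0F 3F eq = ⊥-elim (distinct-points a-ab d∉ab eq)
      injective 1F 0F eq = ⊥-elim (≢-sym a≢b eq)
      injective 1F 1F eq = refl
      injective 1F 2F eq = ⊥-elim (distinct-points b-ab c∉ab eq)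
      injective 1F 3F eq = ⊥-elim (distinct-points b-ab d∉ab eq)
      injective 2F 0F eq = ⊥-elim (distinct-points c-cd a∉cd eq)
      injective 2F 1F eq = ⊥-elim (distinct-points c-cd b∉cd eq)
      injective 2F 2F eq = refl
      injective 2F 3F eq = ⊥-elim (c≢d eq)
      injective 3F 0F eq = ⊥-elim (distinct-points d-cd a∉cd eq)
      injective 3F 1F eq = ⊥-elim (distinct-points d-cd b∉cd eq)
      injective 3F 2F eq = ⊥-elim (≢-sym c≢d eq)
      injective 3F 3F eq = refl

    noThree : ∀ l {i j k} → i ≢ j → i ≢ k → j ≢ k →
              value (vertex i) I l → value (vertex j) I l → value (vertex k) I l → ⊥
    noThree l {0F} {1F} {2F} _ _ _ x y z = no-abc l x y z
    noThree l {0F} {1F} {3F} _ _ _ x y z = no-abd l x y z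
    noThree l {0F} {2F} {1F} _ _ _ x y z = no-abc l x z y
    noThree l {0F} {2F} {3F} _ _ _ x y z = no-acd l x y z
    noThree l {0F} {3F} {1F} _ _ _ x y z = no-abd l x z y
    noThree l {0F} {3F} {2F} _ _ _ x y z = no-acd l x z y
    noThree l {1F} {0F} {2F} _ _ _ x y z = no-abc l y x z
    noThree l {1F} {0F} {3F} _ _ _ x y z = no-abd l y x z
    noThree l {1F} {2F} {0F} _ _ _ x y z = no-abc l z x y
    noThree l {1F} {2F} {3F} _ _ _ x y z = no-bcd l x y z
    noThree l {1F} {3F} {0F} _ _ _ x y z = no-abd l z x y
    noThree l {1F} {3F} {2F} _ _ _ x y z = no-bcd l x z y
    noThree l {2F} {0F} {1F} _ _ _ x y z = no-abc l y z x
    noThree l {2F} {0F} {3F} _ _ _ x y z = no-acd l y x z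
    noThree l {2F} {1F} {0F} _ _ _ x y z = no-abc l z y x
    noThree l {2F} {1F} {3F} _ _ _ x y z = no-bcd l y x z
    noThree l {2F} {3F} {0F} _ _ _ x y z = no-acd l z x y
    noThree l {2F} {3F} {1F} _ _ _ x y z = no-bcd l z x y
    noThree l {3F} {0F} {1F} _ _ _ x y z = no-abd l y z x
    noThree l {3F} {0F} {2F} _ _ _ x y z = no-acd l y z x
    noThree l {3F} {1F} {0F} _ _ _ x y z = no-abd l z y x
    noThree l {3F} {1F} {2F} _ _ _ x y z = no-bcd l y z x
    noThree l {3F} {2F} {0F} _ _ _ x y z = no-acd l z y x
    noThree l {3F} {2F} {1F} _ _ _ x y z = no-bcd l z y x
    noThree l {0F} {0F} i≢j _ _ = ⊥-elim (i≢j refl)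
    noThree l {1F} {1F} i≢j _ _ = ⊥-elim (i≢j refl)
    noThree l {2F} {2F} i≢j _ _ = ⊥-elim (i≢j refl)
    noThree l {3F} {3F} i≢j _ _ = ⊥-elim (i≢j refl)
    noThree l {0F} {_} {0F} _ i≢k _ = ⊥-elim (i≢k refl)
    noThree l {1F} {_} {1F} _ i≢k _ = ⊥-elim (i≢k refl)
    noThree l {2F} {_} {2F} _ i≢k _ = ⊥-elim (i≢k refl)
    noThree l {3F} {_} {3F} _ i≢k _ = ⊥-elim (i≢k refl)
    noThree l {_} {0F} {0F} _ _ j≢k = ⊥-elim (j≢k refl)
    noThree l {_} {1F} {1F} _ _ j≢k = ⊥-elim (j≢k refl)
    noThree l {_} {2F} {2F} _ _ j≢k = ⊥-elim (j≢k refl)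
    noThree l {_} {3F} {3F} _ _ j≢k = ⊥-elim (j≢k refl)

  -- Near-pencils and degenerate subplanes

  -- Membership of `o` in `Q` is left open, so collinear sets and fans are treated together.
  NearPencil : Pred Point ℓ → Set ℓ
  NearPencil Q = ∃[ l ] ∃[ o ] (∀ p → Q p → p ≢ o → p I l)

  -- A join of two points of `Q` other than `l` passes through `o`, which is then in `Q`, and cuts
  -- `l` in a point of `Q`; hence meets stay in `Q`. Among four distinct points three differ from
  -- `o`, and these lie on `l`, which is then itself a join.
  nearPencil⇒degenerate : NearPencil Q → IsDegenerateSubplane S Q
  nearPencil⇒degenerate {Q = Q} (l , o , on-l) = linesOf Q , record
    { p1 = linesOf-p1
    ; p2 = closed⇒p2 closed
    ; ¬p3 = λ (v , inj , noThree) → four-points v inj noThree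
    }
    where
    through-o : ∀ {m} → linesOf Q m → m ≢ l → Q o × o I m
    through-o (p , q , p≢q , p∈ , q∈ , pm , qm) m≢l with em {P = p ≡ o} | em {P = q ≡ o}
    ... | yes refl | _        = p∈ , pm
    ... | no _     | yes refl = q∈ , qm
    ... | no p≢o   | no q≢o   =
      ⊥-elim (m≢l (line-≡ p≢q pm qm (on-l p p∈ p≢o) (on-l q q∈ q≢o)))

    meets-l : ∀ {m} → linesOf Q m → m ≢ l → Q (meet m l)
    meets-l {m} (p , q , p≢q , p∈ , q∈ , pm , qm) m≢l with em {P = p ≡ o}
    ... | yes refl = subst Q (sym (meet-≡ m≢l qm (on-l q q∈ (≢-sym p≢q)))) q∈
    ... | no p≢o   = subst Q (sym (meet-≡ m≢l pm (on-l p p∈ p≢o))) p∈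

    closed : ∀ {m m′} → m ≢ m′ → linesOf Q m → linesOf Q m′ → Q (meet m m′)
    closed {m} {m′} m≢m′ m∈ m′∈ with em {P = m ≡ l} | em {P = m′ ≡ l}
    ... | yes refl | yes refl = ⊥-elim (m≢m′ refl)
    ... | no m≢l   | yes refl = meets-l m∈ m≢l
    ... | yes refl | no m′≢l  =
      subst Q (sym (meet-≡ m≢m′ (meet-Iʳ m′≢l) (meet-Iˡ m′≢l))) (meets-l m′∈ m′≢l)
    ... | no m≢l   | no m′≢l  =
      subst Q (sym (meet-≡ m≢m′ (proj₂ (through-o m∈ m≢l)) (proj₂ (through-o m′∈ m′≢l))))
        (proj₁ (through-o m∈ m≢l))

    four-points : (v : Fin 4 → [ p ∈ Point ∣ Q p ]) → Injective _≡_ _≡_ v →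
      (∀ {i j k} → i ≢ j → i ≢ k → j ≢ k →
        ¬ (∃[ m ] value (v i) I value m × value (v j) I value m × value (v k) I value m)) → ⊥
    four-points v inj noThree = choose (em {P = V 0F ≡ o}) (em {P = V 1F ≡ o}) (em {P = V 2F ≡ o})
      where
      V : Fin 4 → Point
      V i = value (v i)
      V∈Q : ∀ i → Q (V i)
      V∈Q i with v i
      ... | _ , [ q ] = recompute em q
      V-≢ : ∀ {i j} → i ≢ j → V i ≢ V j
      V-≢ i≢j eq = i≢j (inj (value-injective eq))
      other : ∀ {i j} → i ≢ j → V i ≡ o → V j ≢ o
      other i≢j i≡o j≡o = V-≢ i≢j (trans i≡o (sym j≡o))
      three-on-l : ∀ {i j k} → i ≢ j → i ≢ k → j ≢ k → V i ≢ o → V j ≢ o → V k ≢ o → ⊥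
      three-on-l {i} {j} {k} i≢j i≢k j≢k i≢o j≢o k≢o =
        noThree i≢j i≢k j≢k ((l , [ _ , _ , V-≢ i≢j , V∈Q i , V∈Q j , il , jl ]) , il , jl , kl)
        where
        il : V i I l
        il = on-l (V i) (V∈Q i) i≢o
        jl : V j I l
        jl = on-l (V j) (V∈Q j) j≢o
        kl : V k I l
        kl = on-l (V k) (V∈Q k) k≢o
      choose : Dec (V 0F ≡ o) → Dec (V 1F ≡ o) → Dec (V 2F ≡ o) → ⊥
      choose (yes e) _ _ = three-on-l {1F} {2F} {3F} (λ ()) (λ ()) (λ ())
        (other (λ ()) e) (other (λ ()) e) (other (λ ()) e)
      choose (no n₀) (yes e) _ = three-on-l {0F} {2F} {3F} (λ ()) (λ ()) (λ ())
        n₀ (other (λ ()) e) (other (λ ()) e)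
      choose (no n₀) (no n₁) (yes e) = three-on-l {0F} {1F} {3F} (λ ()) (λ ()) (λ ())
        n₀ n₁ (other (λ ()) e)
      choose (no n₀) (no n₁) (no n₂) = three-on-l {0F} {1F} {2F} (λ ()) (λ ()) (λ ()) n₀ n₁ n₂

  -- Sets with two points off every line

  -- Avoiding an arbitrary `o` besides `l` encodes that at least two points of `Q` are off `l`: a
  -- first one can be passed as `o` to obtain a second.
  Spread : Pred Point ℓ → Set ℓ
  Spread Q = ∀ l o → ∃[ p ] Q p × p ≢ o × ¬ p I l

  ¬nearPencil⇒spread : ¬ NearPencil Q → Spread Q
  ¬nearPencil⇒spread ¬np l o = stable λ ¬∃ → ¬np
    (l , o , λ p p∈ p≢o → stable λ p∉l → ¬∃ (p , p∈ , p≢o , p∉l))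

  spread⇒noncollinear : Spread Q → Noncollinear Q
  spread⇒noncollinear sp l = let p , p∈ , _ , p∉l = sp l point₀ in p , p∈ , p∉l

  module _ {Q : Pred Point ℓ} (sp : Spread Q) where
    -- The line `de` cuts `l` once, so it misses two of the three points `a`, `b`, `c`; those two
    -- and `d`, `e` form the quadrangle.
    quadrangle-through : ∀ {a b c l} → a ≢ b → a ≢ c → b ≢ c → Q a → Q b → Q c →
      a I l → b I l → c I l → ∀ {d e} → d ≢ e → Q d → Q e →
      ¬ d I l → ¬ e I l → Quadrangle Q
    quadrangle-through {a} {b} {c} {l} a≢b a≢c b≢c a∈ b∈ c∈ al bl cl {d} {e} d≢e d∈ e∈ d∉l e∉l =
      pick (em {P = a I de}) (em {P = b I de})
      where
      de : Line
      de = join d e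
      ≢l : de ≢ l
      ≢l = distinct-lines (join-Iˡ d≢e) d∉l
      mk : ∀ {x y} → x ≢ y → Q x → Q y → x I l → y I l → ¬ x I de → ¬ y I de → Quadrangle Q
      mk x≢y x∈ y∈ xl yl x∉ y∉ = record
        { a≢b = x≢y ; c≢d = d≢e ; a∈Q = x∈ ; b∈Q = y∈ ; c∈Q = d∈ ; d∈Q = e∈
        ; a-ab = xl ; b-ab = yl ; c-cd = join-Iˡ d≢e ; d-cd = join-Iʳ d≢e
        ; a∉cd = x∉ ; b∉cd = y∉ ; c∉ab = d∉l ; d∉ab = e∉l }
      only : ∀ {x y} → x ≢ y → x I l → y I l → x I de → ¬ y I de
      only x≢y xl yl xde yde = x≢y (point-≡ ≢l xde xl yde yl)
      pick : Dec (a I de) → Dec (b I de) → Quadrangle Q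
      pick (yes a-de) _ = mk b≢c b∈ c∈ bl cl (only a≢b al bl a-de) (only a≢c al cl a-de)
      pick (no a∉) (no b∉) = mk a≢b a∈ b∈ al bl a∉ b∉
      pick (no a∉) (yes b-de) = mk a≢c a∈ c∈ al cl a∉ (only b≢c bl cl b-de)

    -- The only obstruction is that `a` or `b` lies on `cd`. Then `cd` carries three of the points,
    -- the remaining one is off it, and a further point `e` off it completes the input of
    -- `quadrangle-through`.
    spread⇒quadrangle : Quadrangle Q
    spread⇒quadrangle
      -- `line₀` and `point₀` are fillers; from the first two choices only `a` ≠ `b` is kept.
      with a , a∈ , _ , _       ← sp line₀ point₀
      with b , b∈ , b≢a , _     ← sp line₀ a
      with c , c∈ , _ , c∉ab    ← sp (join a b) a
      with d , d∈ , d≢c , d∉ab  ← sp (join a b) c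
      with em {P = a I join c d} | em {P = b I join c d}
    ... | no a∉ | no b∉ = record
      { a≢b = ≢-sym b≢a ; c≢d = ≢-sym d≢c ; a∈Q = a∈ ; b∈Q = b∈ ; c∈Q = c∈ ; d∈Q = d∈
      ; a-ab = join-Iˡ (≢-sym b≢a) ; b-ab = join-Iʳ (≢-sym b≢a)
      ; c-cd = join-Iˡ (≢-sym d≢c) ; d-cd = join-Iʳ (≢-sym d≢c)
      ; a∉cd = a∉ ; b∉cd = b∉ ; c∉ab = c∉ab ; d∉ab = d∉ab }
    ... | yes a-cd | _ =
      let e , e∈ , e≢b , e∉cd = sp (join c d) b in
      quadrangle-through (distinct-points (join-Iˡ (≢-sym b≢a)) c∉ab)
        (distinct-points (join-Iˡ (≢-sym b≢a)) d∉ab) (≢-sym d≢c) a∈ c∈ d∈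
        a-cd (join-Iˡ (≢-sym d≢c)) (join-Iʳ (≢-sym d≢c)) (≢-sym e≢b) b∈ e∈
        (λ b-cd → d∉ab (subst (d I_)
          (line-≡ (≢-sym b≢a) a-cd b-cd (join-Iˡ (≢-sym b≢a)) (join-Iʳ (≢-sym b≢a)))
          (join-Iʳ (≢-sym d≢c))))
        e∉cd
    ... | no a∉cd | yes b-cd =
      let e , e∈ , e≢a , e∉cd = sp (join c d) a in
      quadrangle-through (distinct-points (join-Iʳ (≢-sym b≢a)) c∉ab)
        (distinct-points (join-Iʳ (≢-sym b≢a)) d∉ab) (≢-sym d≢c) b∈ c∈ d∈
        b-cd (join-Iˡ (≢-sym d≢c)) (join-Iʳ (≢-sym d≢c)) (≢-sym e≢a) a∈ e∈ a∉cd e∉cd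

  -- Closure when a single new point appears

  -- If px is not a line of Q, take two lines m, m′ of Q through x and a point y′ of Q on m.
  -- Projecting m′ from y′ to a line k of Q, and k from p back to m′, is an injective self-map
  -- of the finite set Q⁺ ∩ m′ that misses x.
  module OneExtraPoint {Q : Pred Point ℓ} {x : Point} (e : Enumeration (pointsOf (linesOf Q)))
    (nc : Noncollinear Q) (x∉Q : ¬ Q x)
    (only : ∀ {p} → pointsOf (linesOf Q) p → p ≢ x → Q p) where

    private
      Q⁺ : Pred Point ℓ
      Q⁺ = pointsOf (linesOf Q)

      Q≢x : Q p → p ≢ x
      Q≢x p∈ refl = x∉Q p∈

    perspectivity-contradiction : ∀ {p y y′ w m m′} → Q⁺ x → Q p → Q y → Q y′ → Q w →
      linesOf Q m → linesOf Q m′ → m ≢ m′ → x I m → x I m′ → y I m → y′ I m → y ≢ y′ → w I m′ →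
      ¬ linesOf Q (join p x) → ¬ p I join y w → ⊥
    perspectivity-contradiction {p} {y} {y′} {w} {m} {m′}
      x∈ p∈ y∈ y′∈ w∈ m∈ m′∈ m≢m′ xm xm′ ym y′m y≢y′ wm′ px∉ p∉k =
      -- `x` and the images of `zs` would be `suc (length zs)` distinct elements of `zs`.
      1+n≰n (≤-trans (≤-reflexive (cong suc (sym (length-map f zs))))
                     (unique-⊆⇒length≤ (All.tabulate x∉ ∷ map-unique f-injective (unique pts)) ⊆zs))
      where
      at-x : ∀ {z} → z I m → z I m′ → z ≡ x
      at-x zm zm′ = point-≡ m≢m′ zm zm′ xm xm′
      y≢w : y ≢ w
      y≢w refl = Q≢x y∈ (at-x ym wm′)
      k : Line
      k = join y w
      k≢m : k ≢ m
      k≢m eq = Q≢x w∈ (at-x (subst (w I_) eq (join-Iʳ y≢w)) wm′)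
      x∉k : ¬ x I k
      x∉k xk = k≢m (line-≡ (Q≢x y∈) (join-Iˡ y≢w) xk ym xm)
      y′∉k : ¬ y′ I k
      y′∉k y′k = k≢m (line-≡ y≢y′ (join-Iˡ y≢w) y′k ym y′m)
      y′∉m′ : ¬ y′ I m′
      y′∉m′ y′m′ = Q≢x y′∈ (at-x y′m y′m′)
      p∉m′ : ¬ p I m′
      p∉m′ pm′ = px∉ (subst (linesOf Q) (sym (join-≡ (Q≢x p∈) pm′ xm′)) m′∈)
      pts : Enumeration (λ z → Q⁺ z × z I m′)
      pts = ⊆-list⇒enumeration (list e) λ (z∈ , _) → complete e z∈
      zs : List Point
      zs = list pts
      f : Point → Point
      f z = project p m′ (project y′ k z)
      module _ {z} (z∈ : Q⁺ z) (zm′ : z I m′) where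
        y′≢z : y′ ≢ z
        y′≢z = ≢-sym (distinct-points zm′ y′∉m′)
        -- `z` may be `x`, which is outside `Q`; its join with `y′` is then `m`, still a line of
        -- `Q`.
        y′z∈ : linesOf Q (join y′ z)
        y′z∈ with em {P = z ≡ x}
        ... | yes refl = subst (linesOf Q) (sym (join-≡ y′≢z y′m xm)) m∈
        ... | no z≢x   = join∈linesOf y′≢z y′∈ (only z∈ z≢x)
        z′ : Point
        z′ = project y′ k z
        z′-k : z′ I k
        z′-k = project-I y′∉k y′≢z
        -- Since `k` misses `x`, the intermediate image is a point of `Q⁺` other than `x`, so it is
        -- back in `Q`.
        z′∈ : Q z′
        z′∈ = only (meet∈pointsOf (distinct-lines (join-Iˡ y′≢z) y′∉k) y′z∈ (join∈linesOf y≢w y∈ w∈))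
                   (distinct-points z′-k x∉k)
        p≢z′ : p ≢ z′
        p≢z′ = ≢-sym (distinct-points z′-k p∉k)
        f-m′ : f z I m′
        f-m′ = project-I p∉m′ p≢z′
        f∈ : Q⁺ (f z)
        f∈ = meet∈pointsOf (distinct-lines (join-Iˡ p≢z′) p∉m′) (join∈linesOf p≢z′ p∈ z′∈) m′∈
        -- Otherwise the line from `p` to the intermediate image would be `px`, and it is a line of
        -- `Q`.
        f≢x : f z ≢ x
        f≢x eq = px∉ (subst (linesOf Q)
          (sym (join-≡ (Q≢x p∈) (join-Iˡ p≢z′) (subst (_I join p z′) eq (project-I-join p∉m′ p≢z′))))
          (join∈linesOf p≢z′ p∈ z′∈))
      f-injective : ∀ {z t} → z ∈ zs → t ∈ zs → f z ≡ f t → z ≡ t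
      f-injective z∈ t∈ eq with sound pts z∈ | sound pts t∈
      ... | z∈Q⁺ , zm′ | t∈Q⁺ , tm′ = project-injective y′∉k y′∉m′ zm′ tm′
        (project-injective p∉m′ p∉k (z′-k z∈Q⁺ zm′) (z′-k t∈Q⁺ tm′) eq)
      x∉ : ∀ {z} → z ∈ map f zs → x ≢ z
      x∉ z∈ x≡z with ∈-map⁻ f z∈
      ... | t , t∈ , refl = uncurry f≢x (sound pts t∈) (sym x≡z)
      ⊆zs : ∀ {z} → z ∈ x ∷ map f zs → z ∈ zs
      ⊆zs (here refl) = complete pts (x∈ , xm′)
      ⊆zs (there z∈) with ∈-map⁻ f z∈
      ... | t , t∈ , refl = let t∈Q⁺ , tm′ = sound pts t∈ in complete pts (f∈ t∈Q⁺ tm′ , f-m′ t∈Q⁺ tm′)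

    -- The perspectivity argument requires `p` off the auxiliary line `yw`. One of the two points
    -- `w`, `w′` of `Q` on `m′` qualifies: if `p` were on both `yw` and `yw′`, these would be a
    -- single line, hence `m′`, which misses `y`.
    join-x : Q⁺ x → Q p → linesOf Q (join p x)
    join-x {p} x∈@(m , m′ , m≢m′ , m∈@(y , y′ , y≢y′ , y∈ , y′∈ , ym , y′m) ,
                   m′∈@(w , w′ , w≢w′ , w∈ , w′∈ , wm′ , w′m′) , xm , xm′) p∈ = stable λ px∉ →
      let contradiction-from = λ {w} (w∈ : Q w) (wm′ : w I m′) →
            perspectivity-contradiction x∈ p∈ y∈ y′∈ w∈ m∈ m′∈ m≢m′ xm xm′ ym y′m y≢y′ wm′ px∉
          p-yw  = stable (contradiction-from w∈ wm′)
          p-yw′ = stable (contradiction-from w′∈ w′m′)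
          y≢p   = λ { refl → px∉ (subst (linesOf Q) (sym (join-≡ (Q≢x y∈) ym xm)) m∈) }
          same  = line-≡ y≢p (join-Iˡ y≢w) p-yw (join-Iˡ y≢w′) p-yw′
      in y∉m′ (subst (y I_)
           (line-≡ w≢w′ (join-Iʳ y≢w) (subst (w′ I_) (sym same) (join-Iʳ y≢w′)) wm′ w′m′)
           (join-Iˡ y≢w))
      where
      y∉m′ : ¬ y I m′
      y∉m′ ym′ = Q≢x y∈ (point-≡ m≢m′ ym ym′ xm xm′)
      y≢w : y ≢ w
      y≢w = ≢-sym (distinct-points wm′ y∉m′)
      y≢w′ : y ≢ w′
      y≢w′ = ≢-sym (distinct-points w′m′ y∉m′)

    linesOf-next⊆ : linesOf Q⁺ l → linesOf Q l
    linesOf-next⊆ (p , q , p≢q , p∈ , q∈ , pl , ql) with em {P = p ≡ x} | em {P = q ≡ x}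
    ... | yes refl | yes refl = ⊥-elim (p≢q refl)
    ... | yes refl | no q≢x = subst (linesOf Q) (join-≡ (≢-sym p≢q) ql pl) (join-x p∈ (only q∈ q≢x))
    ... | no p≢x | yes refl = subst (linesOf Q) (join-≡ p≢q pl ql) (join-x q∈ (only p∈ p≢x))
    ... | no p≢x | no q≢x = p , q , p≢q , only p∈ p≢x , only q∈ q≢x , pl , ql

  -- Pencils and grids

  -- The excluded line `l` will be the join of two centres, the only line their pencils could share.
  record Pencil (p : Point) (l : Line) (M : Pred Line ℓ) : Set ℓ where
    field
      members : List Line
      unique  : Unique members
      through : ∀ {m} → m ∈ members → p I m
      avoids  : ∀ {m} → m ∈ members → m ≢ l
      inside  : ∀ {m} → m ∈ members → M m
    size : ℕ
    size = length members

  open Pencil using (size)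

  -- Distinct points give distinct joins, of which at most one is the excluded line; this costs the
  -- `suc`.
  joins⇒pencil : (l : Line) (ps : List Point) → Unique ps →
    (∀ {q} → q ∈ ps → o ≢ q × M (join o q)) →
    (∀ {p q} → p ∈ ps → q ∈ ps → join o p ≡ join o q → p ≡ q) →
    Σ[ c ∈ Pencil o l M ] length ps ≤ suc (size c)
  joins⇒pencil {o = o} {M = M} l ps u good inj = record
    { members = members
    ; unique  = filter⁺ (λ m → ¬? (em {P = m ≡ l})) lines!
    ; through = λ m∈ → proj₁ (on (proj₁ (split m∈)))
    ; avoids  = λ m∈ → proj₂ (split m∈)
    ; inside  = λ m∈ → proj₂ (on (proj₁ (split m∈)))
    } , ≤-trans (≤-reflexive (sym (length-map (join o) ps))) (length≤1+deleteAll l lines!)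
    where
    lines! : Unique (map (join o) ps)
    lines! = map-unique inj u
    members : List Line
    members = deleteAll l (map (join o) ps)
    split : ∀ {m} → m ∈ members → m ∈ map (join o) ps × m ≢ l
    split = ∈-filter⁻ (λ m → ¬? (em {P = m ≡ l})) {xs = map (join o) ps}
    on : ∀ {m} → m ∈ map (join o) ps → o I m × M m
    on m∈ with ∈-map⁻ (join o) m∈
    ... | q , q∈ , refl = let o≢q , jm = good q∈ in join-Iˡ o≢q , jm

  -- A grid point is off `l`, hence different from both centres, and so determines the pair of lines
  -- it came from. That it is off `l` is also recorded in the result, so that points on `l` can be
  -- added without overlap.
  grid : p ≢ q → p I l → q I l → (c : Pencil p l M) (d : Pencil q l M) →
         ∃[ zs ] Unique zs × (∀ {z} → z ∈ zs → pointsOf M z × ¬ z I l) ×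
                 length zs ≡ size c * size d
  grid {p} {q} {l} {M} p≢q pl ql c d =
    map point pairs , map-unique point-injective (cartesianProduct⁺ (unique c) (unique d)) ,
    in-grid , trans (length-map point pairs) (length-cartesianProduct (members c) (members d))
    where
    open Pencil
    pairs : List (Line × Line)
    pairs = cartesianProduct (members c) (members d)
    point : Line × Line → Point
    point = uncurry meet
    module _ {m n : Line} (mn∈ : (m , n) ∈ pairs) where
      m∈ : m ∈ members c
      m∈ = proj₁ (∈-cartesianProduct⁻ (members c) (members d) mn∈)
      n∈ : n ∈ members d
      n∈ = proj₂ (∈-cartesianProduct⁻ (members c) (members d) mn∈)
      p∉n : ¬ p I n
      p∉n pn = avoids d n∈ (line-≡ p≢q pn (through d n∈) pl ql)
      m≢n : m ≢ n
      m≢n = distinct-lines (through c m∈) p∉n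
      z-m : meet m n I m
      z-m = meet-Iˡ m≢n
      z-n : meet m n I n
      z-n = meet-Iʳ m≢n
      z∉l : ¬ meet m n I l
      z∉l zl = p∉n (subst (_I n) (point-≡ (avoids c m∈) z-m zl (through c m∈) pl) z-n)
      z∈ : pointsOf M (meet m n)
      z∈ = meet∈pointsOf m≢n (inside c m∈) (inside d n∈)
    point-injective : ∀ {x y} → x ∈ pairs → y ∈ pairs → point x ≡ point y → x ≡ y
    point-injective {m , n} {m′ , n′} x∈ y∈ eq = cong₂ _,_
      (line-≡ (distinct-points pl (z∉l x∈)) (through c (m∈ x∈)) (z-m x∈)
        (through c (m∈ y∈)) (subst (_I m′) (sym eq) (z-m y∈)))
      (line-≡ (distinct-points ql (z∉l x∈)) (through d (n∈ x∈)) (z-n x∈)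
        (through d (n∈ y∈)) (subst (_I n′) (sym eq) (z-n y∈)))
    in-grid : ∀ {z} → z ∈ map point pairs → pointsOf M z × ¬ z I l
    in-grid z∈′ with ∈-map⁻ point z∈′
    ... | (m , n) , mn∈ , refl = z∈ mn∈ , z∉l mn∈

  -- Growth of a spread set

  module Growth {P : Pred Point ℓ} (e : Enumeration P) (sp : Spread P) where

    P₁ P₂ P₃ : Pred Point ℓ
    P₁ = points S P 1
    P₂ = points S P 2
    P₃ = points S P 3

    nc₀ : Noncollinear P
    nc₀ = spread⇒noncollinear sp
    nc₁ : Noncollinear P₁
    nc₁ = noncollinear-next nc₀
    nc₂ : Noncollinear P₂
    nc₂ = noncollinear-next nc₁

    P⊆P₁ : P p → P₁ p
    P⊆P₁ = ⊆pointsOf-linesOf nc₀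
    P₁⊆P₂ : P₁ p → P₂ p
    P₁⊆P₂ = ⊆pointsOf-linesOf nc₁
    P₂⊆P₃ : P₂ p → P₃ p
    P₂⊆P₃ = ⊆pointsOf-linesOf nc₂

    ps : List Point
    ps = list e

    n : ℕ
    n = length ps

    on? : (l : Line) → Decidable (_I l)
    on? l _ = em

    ps-on ps-off : Line → List Point
    ps-on  l = filter (on? l) ps
    ps-off l = filter (¬? ∘ on? l) ps

    ∈ps-on⁻ : ∀ l {p} → p ∈ ps-on l → P p × p I l
    ∈ps-on⁻ l p∈ = let p∈ps , pl = ∈-filter⁻ (on? l) {xs = ps} p∈ in sound e p∈ps , pl

    ∈ps-off⁻ : ∀ l {p} → p ∈ ps-off l → P p × ¬ p I l
    ∈ps-off⁻ l p∈ = let p∈ps , p∉l = ∈-filter⁻ (¬? ∘ on? l) {xs = ps} p∈ in sound e p∈ps , p∉l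

    4≤n : 4 ≤ n
    4≤n = unique-⊆⇒length≤ {xs = a ∷ b ∷ c ∷ d ∷ []}
      ( (a≢b ∷ distinct-points a-ab c∉ab ∷ distinct-points a-ab d∉ab ∷ [])
      ∷ (distinct-points b-ab c∉ab ∷ distinct-points b-ab d∉ab ∷ [])
      ∷ (c≢d ∷ []) ∷ [] ∷ [])
      λ { (here refl) → complete e a∈Q
        ; (there (here refl)) → complete e b∈Q
        ; (there (there (here refl))) → complete e c∈Q
        ; (there (there (there (here refl)))) → complete e d∈Q }
      where open Quadrangle (spread⇒quadrangle sp)

    Large : Set ℓ
    Large = ∃[ m ] HasCardinality P₃ m × 4 * m ≥ n ^ 2

    large : (zs : List Point) → Unique zs → (∀ {z} → z ∈ zs → P₃ z) → n ^ 2 ≤ 4 * length zs → Large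
    large zs u zs⊆ bound = _ , enumeration⇒hasCardinality e₃ ,
      ≤-trans bound (*-monoʳ-≤ 4 (unique-⊆⇒length≤ u (complete e₃ ∘ zs⊆)))
      where
      e₃ : Enumeration P₃
      e₃ = enumerate-next (enumerate-next (enumerate-next e))

    two-off : ∀ l → ∃[ p ] ∃[ q ] p ≢ q × P p × P q × ¬ p I l × ¬ q I l
    two-off l =
      let p , p∈ , _ , p∉l   = sp l point₀
          q , q∈ , q≢p , q∉l = sp l p
      in p , q , ≢-sym q≢p , p∈ , q∈ , p∉l , q∉l

    -- The line `m` cuts `l` once, so it removes at most one of three points.
    avoid-one : ∀ {zs : List Point} {l m} → l ≢ m → Unique zs → 3 ≤ length zs →
      (∀ {z} → z ∈ zs → z I l) →
      ∃[ u ] ∃[ v ] u ≢ v × u ∈ zs × v ∈ zs × ¬ u I m × ¬ v I m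
    avoid-one {u ∷ v ∷ w ∷ _} {l} {m} l≢m ((u≢v ∷ u≢w ∷ _) ∷ (v≢w ∷ _) ∷ _) (s≤s (s≤s (s≤s _))) on-l
      with em {P = u I m} | em {P = v I m}
    ... | no u∉m | no v∉m = u , v , u≢v , here refl , there (here refl) , u∉m , v∉m
    ... | yes um | _ = v , w , v≢w , there (here refl) , there (there (here refl)) ,
      (λ vm → u≢v (point-≡ l≢m (on-l (here refl)) um (on-l (there (here refl))) vm)) ,
      (λ wm → u≢w (point-≡ l≢m (on-l (here refl)) um (on-l (there (there (here refl)))) wm))
    ... | no u∉m | yes vm = u , w , u≢w , here refl , there (there (here refl)) , u∉m ,
      (λ wm → v≢w (point-≡ l≢m (on-l (there (here refl))) vm (on-l (there (there (here refl)))) wm))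

    -- The grid of two points p, q off m misses the line pq, and projecting the points of P
    -- on m from a grid point r to pq adds as many points of P₂ on pq.
    rich-line⇒large : ∀ m → n < 2 * length (ps-on m) → Large
    rich-line⇒large m rich
      with p , q , p≢q , p∈ , q∈ , p∉m , q∉m ← two-off m
      with u , v , u≢v , u∈us , v∈us , u∉pq , v∉pq ←
        avoid-one (≢-sym (distinct-lines (join-Iˡ p≢q) p∉m))
          (filter⁺ (on? m) (unique e)) (3≤half rich 4≤n) (proj₂ ∘ ∈ps-on⁻ m)
      = large (zs ++ map (project r pq) us)
          (++⁺ zs! (map-unique (λ a∈ b∈ → project-injective r∉pq r∉m (us-m a∈) (us-m b∈)) us!) disjoint)
          in-P₃
          (≤-trans (rich-bound rich (proj₂ c) (proj₂ d)) (*-monoʳ-≤ 4 (≤-reflexive (sym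
            (trans (length-++ zs) (cong₂ _+_ zs-length (length-map (project r pq) us)))))))
      where
      us : List Point
      us = ps-on m
      us! : Unique us
      us! = filter⁺ (on? m) (unique e)
      us-P : ∀ {z} → z ∈ us → P z
      us-P = proj₁ ∘ ∈ps-on⁻ m
      us-m : ∀ {z} → z ∈ us → z I m
      us-m = proj₂ ∘ ∈ps-on⁻ m
      pq : Line
      pq = join p q
      pencil : ∀ {o} → P o → ¬ o I m → Σ[ c ∈ Pencil o pq (linesOf P) ] length us ≤ suc (size c)
      pencil o∈ o∉m = joins⇒pencil pq us us!
        (λ z∈ → let o≢z = ≢-sym (distinct-points (us-m z∈) o∉m) in
                o≢z , join∈linesOf o≢z o∈ (us-P z∈))
        (λ a∈ b∈ → join-injective o∉m (us-m a∈) (us-m b∈))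
      c = pencil p∈ p∉m
      d = pencil q∈ q∉m
      the-grid = grid p≢q (join-Iˡ p≢q) (join-Iʳ p≢q) (proj₁ c) (proj₁ d)
      zs : List Point
      zs = proj₁ the-grid
      zs! : Unique zs
      zs! = proj₁ (proj₂ the-grid)
      zs-grid : ∀ {z} → z ∈ zs → P₁ z × ¬ z I pq
      zs-grid = proj₁ (proj₂ (proj₂ the-grid))
      zs-length : length zs ≡ size (proj₁ c) * size (proj₁ d)
      zs-length = proj₂ (proj₂ (proj₂ the-grid))
      p≢u : p ≢ u
      p≢u = ≢-sym (distinct-points (us-m u∈us) p∉m)
      q≢v : q ≢ v
      q≢v = ≢-sym (distinct-points (us-m v∈us) q∉m)
      q∉pu : ¬ q I join p u
      q∉pu qpu = u∉pq (subst (u I_)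
        (line-≡ p≢q (join-Iˡ p≢u) qpu (join-Iˡ p≢q) (join-Iʳ p≢q)) (join-Iʳ p≢u))
      pu≢qv : join p u ≢ join q v
      pu≢qv = ≢-sym (distinct-lines (join-Iˡ q≢v) q∉pu)
      -- A centre in P₁, so that its projections land in P₂. It is off `m` because `u` ≠ `v`, and
      -- off `pq` because `u` and `v` are.
      r : Point
      r = meet (join p u) (join q v)
      r-pu : r I join p u
      r-pu = meet-Iˡ pu≢qv
      r-qv : r I join q v
      r-qv = meet-Iʳ pu≢qv
      r∈ : P₁ r
      r∈ = meet∈pointsOf pu≢qv (join∈linesOf p≢u p∈ (us-P u∈us)) (join∈linesOf q≢v q∈ (us-P v∈us))
      r∉m : ¬ r I m
      r∉m rm = u≢v (trans (point-≡ (distinct-lines (join-Iˡ p≢u) p∉m) (join-Iʳ p≢u) (us-m u∈us) r-pu rm)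
                          (point-≡ (distinct-lines (join-Iˡ q≢v) q∉m) r-qv rm (join-Iʳ q≢v) (us-m v∈us)))
      r∉pq : ¬ r I pq
      r∉pq rpq = q∉pu (subst (_I join p u)
        (point-≡ (≢-sym (distinct-lines (join-Iʳ q≢v) v∉pq)) rpq r-qv (join-Iʳ p≢q) (join-Iˡ q≢v))
        r-pu)
      r≢ : ∀ {z} → z ∈ us → r ≢ z
      r≢ z∈ = ≢-sym (distinct-points (us-m z∈) r∉m)
      disjoint : ∀ {z} → z ∈ zs × z ∈ map (project r pq) us → ⊥
      disjoint (z∈zs , z∈′) with ∈-map⁻ (project r pq) z∈′
      ... | t , t∈ , refl = proj₂ (zs-grid z∈zs) (project-I r∉pq (r≢ t∈))
      in-P₃ : ∀ {z} → z ∈ zs ++ map (project r pq) us → P₃ z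
      in-P₃ z∈ with ∈-++⁻ zs z∈
      ... | inj₁ z∈zs = P₂⊆P₃ (P₁⊆P₂ (proj₁ (zs-grid z∈zs)))
      ... | inj₂ z∈′ with ∈-map⁻ (project r pq) z∈′
      ... | t , t∈ , refl = P₂⊆P₃ (meet∈pointsOf (distinct-lines (join-Iˡ (r≢ t∈)) r∉pq)
        (join∈linesOf (r≢ t∈) r∈ (P⊆P₁ (us-P t∈)))
        (linesOf-mono P⊆P₁ (join∈linesOf p≢q p∈ q∈)))

    module _ (poor : ∀ m → 2 * length (ps-on m) ≤ n) where

      -- Two points of `qs` with the same join to `x` would span a line of L₀ through `x`, and
      -- `on-secant` allows only one point of `qs` on such a line.
      secants⇒pencil : ∀ {x} l → P₂ x → ¬ P₁ x → (qs : List Point) → Unique qs →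
        (∀ {q} → q ∈ qs → P q) →
        (∀ {m a b} → linesOf P m → x I m → a ∈ qs → b ∈ qs → a I m → b I m → a ≡ b) →
        2 + n ≤ 2 * length qs →
        Σ[ c ∈ Pencil x l (linesOf P₂) ] n ≤ 2 * size c
      secants⇒pencil {x} l x∈ x∉ qs u qs⊆P on-secant enough =
        proj₁ c , drop-one enough (proj₂ c)
        where
        x≢ : ∀ {q} → P q → x ≢ q
        x≢ q∈ refl = x∉ (P⊆P₁ q∈)
        inj : ∀ {p q} → p ∈ qs → q ∈ qs → join x p ≡ join x q → p ≡ q
        inj {p} {q} p∈ q∈ eq = stable λ p≢q → p≢q (on-secant
          (p , q , p≢q , qs⊆P p∈ , qs⊆P q∈ , p-xp , q-xp) (join-Iˡ (x≢ (qs⊆P p∈))) p∈ q∈ p-xp q-xp)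
          where
          p-xp : p I join x p
          p-xp = join-Iʳ (x≢ (qs⊆P p∈))
          q-xp : q I join x p
          q-xp = subst (q I_) (sym eq) (join-Iʳ (x≢ (qs⊆P q∈)))
        c : Σ[ c ∈ Pencil x l (linesOf P₂) ] length qs ≤ suc (size c)
        c = joins⇒pencil l qs u
          (λ q∈ → x≢ (qs⊆P q∈) , join∈linesOf (x≢ (qs⊆P q∈)) x∈ (P₁⊆P₂ (P⊆P₁ (qs⊆P q∈)))) inj

      -- A point of P₂ outside P₁ is on at most one line of L₀, so its joins to the points of P
      -- off that line, and to one point on it, are distinct.
      new-point-pencil : ∀ {x} l → P₂ x → ¬ P₁ x →
        Σ[ c ∈ Pencil x l (linesOf P₂) ] n ≤ 2 * size c
      new-point-pencil {x} l x∈ x∉ with em {P = ∃[ m ] linesOf P m × x I m}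
      ... | no ∄ = secants⇒pencil l x∈ x∉ ps (unique e) (sound e)
        (λ m∈ xm → ⊥-elim (∄ (_ , m∈ , xm))) (2+n≤2*n 4≤n)
      ... | yes (m , m∈@(q , _ , _ , q∈ , _ , qm , _) , xm) =
        secants⇒pencil l x∈ x∉ (q ∷ ps-off m)
          (All.tabulate (λ z∈ → distinct-points qm (proj₂ (∈ps-off⁻ m z∈))) ∷
            filter⁺ (¬? ∘ on? m) (unique e))
          (λ { (here refl) → q∈ ; (there z∈) → proj₁ (∈ps-off⁻ m z∈) })
          (λ m′∈ xm′ a∈ b∈ am′ bm′ →
            -- A second line of L₀ through `x` would put `x` into P₁.
            let same = stable λ m≢m′ → x∉ (m , _ , m≢m′ , m∈ , m′∈ , xm , xm′) in
            trans (is-q a∈ (subst (_ I_) (sym same) am′)) (sym (is-q b∈ (subst (_ I_) (sym same) bm′))))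
          (half-off n (length-filter-¬ (on? m) ps) (poor m))
        where
        is-q : ∀ {z} → z ∈ q ∷ ps-off m → z I m → z ≡ q
        is-q (here refl) _  = refl
        is-q (there z∈)  zm = ⊥-elim (proj₂ (∈ps-off⁻ m z∈) zm)

      two-new-points⇒large : ∀ {x y} → x ≢ y → P₂ x → ¬ P₁ x → P₂ y → ¬ P₁ y → Large
      two-new-points⇒large {x} {y} x≢y x∈ x∉ y∈ y∉ =
        let c , nc = new-point-pencil (join x y) x∈ x∉
            d , nd = new-point-pencil (join x y) y∈ y∉
            zs , zs! , zs-grid , zs-length = grid x≢y (join-Iˡ x≢y) (join-Iʳ x≢y) c d
        in large zs zs! (proj₁ ∘ zs-grid)
             (≤-trans (product-bound {k = size c} {size d} nc nd)
               (*-monoʳ-≤ 4 (≤-reflexive (sym zs-length))))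

    large-or-subplane : Large ⊎ (IsSubplane S P₁ ⊎ IsSubplaneMinusPoint S P₁)
    large-or-subplane with em {P = ∃[ m ] n < 2 * length (ps-on m)}
    ... | yes (m , rich) = inj₁ (rich-line⇒large m rich)
    ... | no ¬rich with em {P = ∃[ x ] P₂ x × ¬ P₁ x}
    ... | no ∄new = inj₂ (inj₁ (closed⇒subplane (quadrangle-mono P⊆P₁ (spread⇒quadrangle sp))
      λ l≢m l∈ m∈ → stable λ ∉P₁ → ∄new (_ , meet∈pointsOf l≢m l∈ m∈ , ∉P₁)))
    ... | yes (x , x∈ , x∉) with em {P = ∃[ y ] P₂ y × ¬ P₁ y × x ≢ y}
    ... | yes (y , y∈ , y∉ , x≢y) =
      inj₁ (two-new-points⇒large (λ m → ≮⇒≥ λ rich → ¬rich (m , rich)) x≢y x∈ x∉ y∈ y∉)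
    ... | no ∄other = inj₂ (inj₂ (P₂ , x ,
      closed⇒subplane (quadrangle-mono (P₁⊆P₂ ∘ P⊆P₁) (spread⇒quadrangle sp))
        (λ l≢m l∈ m∈ → meet∈pointsOf l≢m (linesOf-next⊆ l∈) (linesOf-next⊆ m∈)) ,
      x∈ , (λ p∈ → P₁⊆P₂ p∈ , λ { refl → x∉ p∈ }) , λ (p∈ , x≢p) → only p∈ (≢-sym x≢p)))
      where
      only : P₂ p → p ≢ x → P₁ p
      only p∈ p≢x = stable λ p∉ → ∄other (_ , p∈ , p∉ , ≢-sym p≢x)
      -- Applied with P₁ as `Q` and P₂ as `Q⁺`, so that every line of L₂ is already in L₁.
      open OneExtraPoint (enumerate-next (enumerate-next e)) nc₁ x∉ only

theorem1p1 : (∀ {a} → ExcludedMiddle a) →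
    ∀ {ℓ : Level} (S : IncidenceSystem ℓ) → IsProjectivePlane S →
    (P : Pred (IncidenceSystem.Point S) ℓ) (n : ℕ) → HasCardinality P n →
    (∃[ m ] HasCardinality (points S P 3) m × 4 * m ≥ n ^ 2)
    ⊎ (IsSubplane S (points S P 1) ⊎ IsSubplaneMinusPoint S (points S P 1))
    ⊎ IsDegenerateSubplane S P
theorem1p1 em S plane P n card with em {P = Plane.NearPencil em S plane P}
... | yes near = inj₂ (inj₂ (Plane.nearPencil⇒degenerate em S plane near))
... | no ¬near with Classical.hasCardinality⇒enumeration em card
... | e , refl = [ inj₁ , inj₂ ∘ inj₁ ]′
  (Plane.Growth.large-or-subplane em S plane e (Plane.¬nearPencil⇒spread em S plane ¬near))
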